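{- Let $G$ be a connected graph with at least two vertices and let $k$ be a positive integer. Then $G$ is $k$-partition dimensional if and only if $G$ is $k$-metric dimensional.
   Context: All graphs $G=(V,E)$ are finite, simple, connected and have at least two vertices; $d(x,y)$ is the shortest-path distance in $G$. Metric notions: a vertex $v\in V$ distinguishes two different vertices $x,y$ if $d(v,x)\neq d(v,y)$. A set $S\subseteq V$ is a $k$-metric generator of $G$ if every pair of different vertices of $G$ is distinguished by at least $k$ elements of $S$. A $k$-metric basis is a $k$-metric generator of minimum cardinality. $G$ is $k$-metric dimensional if $k$ is the largest integer such that there exists a $k$-metric basis of $G$. Partition notions: for $a\in V$ and nonempty $S\subseteq V$, $d(a,S)=\min_{v\in S}d(a,v)$; $S$ distinguishes different vertices $x,y$ if $d(x,S)\neq d(y,S)$. A partition $\Pi$ of $V$ (into nonempty sets) is a $k$-partition generator of $G$ if every pair of different vertices of $G$ is distinguished by at least $k$ of the sets of $\Pi$. A $k$-partition basis is a $k$-partition generator of minimum cardinality. $G$ is $k$-partition dimensional if $k$ is the largest integer such that there exists a $k$-partition basis of $G$. -}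

module Defs where

open import Data.Fin using (Fin)
open import Data.Fin.Properties using (_≟_; any?)
open import Data.Fin.Subset using (Subset; _∈_; _∩_; ∣_∣; Nonempty; Empty)
open import Data.Fin.Subset.Properties using (_∈?_)
open import Data.Nat using (ℕ; zero; suc; _≤_; z≤n; s≤s)
import Data.Nat.Properties as ℕ
open import Data.Product using (∃; _×_; _,_; proj₁)
open import Level using (0ℓ)
open import Relation.Binary.Core using (Rel)
open import Relation.Binary.Definitions as B using (Symmetric; Irreflexive)
open import Relation.Binary.PropositionalEquality using (_≡_; _≢_; refl)
open import Relation.Nullary using (yes; no; contradiction)
open import Relation.Nullary.Decidable using (map′; _×-dec_)
open import Relation.Unary using (Pred; Decidable)

IsLeast : Pred ℕ 0ℓ → Pred ℕ 0ℓ
IsLeast P m = P m × (∀ {j} → P j → m ≤ j)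

IsGreatest : Pred ℕ 0ℓ → Pred ℕ 0ℓ
IsGreatest P m = P m × (∀ {j} → P j → j ≤ m)

least : {P : Pred ℕ 0ℓ} → Decidable P → ∃ P → ∃ (IsLeast P)
least {P} P? (m , Pm) = go P? m Pm
  where
  go : {Q : Pred ℕ 0ℓ} → Decidable Q → ∀ m → Q m → ∃ (IsLeast Q)
  go Q? m Qm with Q? zero
  go Q? m       Qm | yes Q0 = zero , Q0 , λ _ → z≤n
  go Q? zero    Q0 | no ¬Q0 = contradiction Q0 ¬Q0
  go Q? (suc m) Qm | no ¬Q0 with go (λ j → Q? (suc j)) m Qm
  ... | l , Ql , l≤ = suc l , Ql , λ { {zero}  Q0 → contradiction Q0 ¬Q0
                                     ; {suc j} Qj → s≤s (l≤ Qj) }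

record Graph (n : ℕ) : Set₁ where
  infix 4 _~_ _~?_
  field
    _~_    : Rel (Fin n) 0ℓ
    _~?_   : B.Decidable _~_
    sym    : Symmetric _~_
    irrefl : Irreflexive _≡_ _~_

module _ {n : ℕ} (G : Graph n) where
  open Graph G

  data Walk : Fin n → Fin n → ℕ → Set where
    []  : ∀ {x} → Walk x x zero
    _∷_ : ∀ {x y z m} → x ~ y → Walk y z m → Walk x z (suc m)

  walk? : ∀ x y → Decidable (Walk x y)
  walk? x y zero    = map′ (λ { refl → [] }) (λ { [] → refl }) (x ≟ y)
  walk? x y (suc m) =
    map′ (λ { (_ , e , w) → e ∷ w }) (λ { (e ∷ w) → _ , e , w })
         (any? λ z → (x ~? z) ×-dec walk? z y m)

  Connected : Set
  Connected = ∀ x y → ∃ (Walk x y)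

-- An indexed family of blocks; nonempty and disjoint blocks are distinct,
-- so p is the number of sets in the partition.
record Partition (n p : ℕ) : Set where
  field
    block    : Fin p → Subset n
    nonempty : ∀ i → Nonempty (block i)
    disjoint : ∀ {i j} → i ≢ j → Empty (block i ∩ block j)
    covers   : ∀ x → ∃ λ i → x ∈ block i

AtLeast : ∀ {m} → ℕ → Pred (Fin m) 0ℓ → Set
AtLeast {m} k P = ∃ λ (T : Subset m) → k ≤ ∣ T ∣ × (∀ {i} → i ∈ T → P i)

module _ {n : ℕ} (G : Graph n) (conn : Connected G) where

  -- A shortest walk repeats no vertex, so walks and paths give the same minimum.
  d : Fin n → Fin n → ℕ
  d x y = proj₁ (least (walk? G x y) (conn x y))

  DistinguishesVertex : Fin n → Fin n → Fin n → Set
  DistinguishesVertex v x y = d v x ≢ d v y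

  IsMetricGenerator : ℕ → Subset n → Set
  IsMetricGenerator k S =
    ∀ {x y} → x ≢ y → AtLeast k (λ v → v ∈ S × DistinguishesVertex v x y)

  IsMetricBasis : ℕ → Subset n → Set
  IsMetricBasis k S =
    IsMetricGenerator k S × (∀ S′ → IsMetricGenerator k S′ → ∣ S ∣ ≤ ∣ S′ ∣)

  MetricDimensional : ℕ → Set
  MetricDimensional = IsGreatest (λ k → ∃ (IsMetricBasis k))

  dSet : Fin n → (S : Subset n) → Nonempty S → ℕ
  dSet a S (v , v∈S) =
    proj₁ (least {λ m → ∃ λ u → u ∈ S × d a u ≡ m}
                 (λ m → any? λ u → (u ∈? S) ×-dec (d a u ℕ.≟ m))
                 (d a v , v , v∈S , refl))

  DistinguishesSet : (S : Subset n) → Nonempty S → Fin n → Fin n → Set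
  DistinguishesSet S ne x y = dSet x S ne ≢ dSet y S ne

  IsPartitionGenerator : ℕ → ∀ {p} → Partition n p → Set
  IsPartitionGenerator k Π =
    ∀ {x y} → x ≢ y → AtLeast k (λ i → DistinguishesSet (block i) (nonempty i) x y)
    where open Partition Π

  IsPartitionBasis : ℕ → ∀ {p} → Partition n p → Set
  IsPartitionBasis k {p} Π =
    IsPartitionGenerator k Π ×
    (∀ {q} (Π′ : Partition n q) → IsPartitionGenerator k Π′ → p ≤ q)

  PartitionDimensional : ℕ → Set
  PartitionDimensional =
    IsGreatest (λ k → ∃ λ p → ∃ λ (Π : Partition n p) → IsPartitionBasis k Π)

{-# OPTIONS --safe #-}
-- If a block separates x from y, then so does some vertex of that block; as
-- blocks are disjoint, a k-partition generator makes the whole vertex set a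
-- k-metric generator.  Conversely, if some k-metric generator exists, then the
-- partition into singletons is a k-partition generator.  A basis exists as soon
-- as a generator does; constructively this minimisation needs an exhaustive
-- search through subsets and partitions.
module Submission where

open import Defs
open import Data.Fin using (Fin; zero; suc)
open import Data.Fin.Properties using (_≟_; any?; all?; suc-injective)
open import Data.Fin.Subset using (Subset; inside; outside; ⊥; ⊤; ⁅_⁆; _∈_; _∉_; _⊂_; _∪_; _∩_; ∣_∣; Nonempty; Empty)
open import Data.Fin.Subset.Properties
  using (_∈?_; anySubset?; nonempty?; ∉⊥; ∈⊤; x∈⁅x⁆; x∈⁅y⁆⇒x≡y; x∈p∩q⁺; x∈p∩q⁻; x∈p∪q⁻; p⊆p∪q; q⊆p∪q; p⊂q⇒∣p∣<∣q∣)
open import Data.Nat using (ℕ; zero; suc; _≤_; z≤n; _≤?_)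
import Data.Nat.Properties as ℕ
open import Data.Product using (∃; _×_; _,_; proj₁; proj₂)
open import Data.Sum using (inj₁; inj₂)
open import Data.Vec using (Vec; []; _∷_; lookup; tabulate; here; there)
open import Data.Vec.Properties using (lookup∘tabulate)
open import Function.Base using (_∘_)
open import Function.Bundles using (_⇔_; mk⇔)
open import Function.Definitions using (Injective)
open import Level using (0ℓ)
open import Relation.Binary.PropositionalEquality using (_≡_; _≢_; refl; sym; trans; subst; subst₂)
open import Relation.Nullary using (Dec; yes; no; contradiction)
open import Relation.Nullary.Decidable using (map′; ¬?; _×-dec_; _→-dec_; decidable-stable)
open import Relation.Unary using (Pred; Decidable)

IsLeast-mono : {P Q : Pred ℕ 0ℓ} → (∀ {j} → Q j → P j) →
               ∀ {l m} → IsLeast P l → IsLeast Q m → l ≤ m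
IsLeast-mono Q⊆P (_ , l≤) (Qm , _) = l≤ (Q⊆P Qm)

-- Distances are defined as least elements, so this allows them to be compared through their
-- defining predicates, without unfolding the search in `least`.
IsLeast-unique : {P Q : Pred ℕ 0ℓ} → (∀ {j} → P j → Q j) → (∀ {j} → Q j → P j) →
                 ∀ {l m} → IsLeast P l → IsLeast Q m → l ≡ m
IsLeast-unique P⊆Q Q⊆P l m = ℕ.≤-antisym (IsLeast-mono Q⊆P l m) (IsLeast-mono P⊆Q m l)

-- Both dimensions are greatest elements, so it is enough to compare the sets of `k` that admit a
-- basis.
IsGreatest-cong : {P Q : Pred ℕ 0ℓ} → (∀ {j} → P j → Q j) → (∀ {j} → Q j → P j) →
                  ∀ {m} → IsGreatest P m → IsGreatest Q m
IsGreatest-cong P⊆Q Q⊆P (Pm , ≤m) = P⊆Q Pm , ≤m ∘ Q⊆P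

-- The image is built by recursion on `T`; injectivity makes each added value new, so the size never
-- falls behind that of `T`. This turns a count of blocks into a count of vertices.
image-AtLeast : ∀ {p n} (f : Fin p → Fin n) → Injective _≡_ _≡_ f → (T : Subset p) →
                AtLeast ∣ T ∣ (λ v → ∃ λ i → i ∈ T × f i ≡ v)
image-AtLeast f inj [] = ⊥ , z≤n , λ v∈⊥ → contradiction v∈⊥ ∉⊥
image-AtLeast f inj (outside ∷ T) with image-AtLeast (f ∘ suc) (suc-injective ∘ inj) T
... | U , T≤U , pre = U , T≤U , λ v∈U → let i , i∈T , eq = pre v∈U in suc i , there i∈T , eq
image-AtLeast f inj (inside ∷ T) with image-AtLeast (f ∘ suc) (suc-injective ∘ inj) T
... | U , T≤U , pre = ⁅ f zero ⁆ ∪ U , ℕ.≤-<-trans T≤U (p⊂q⇒∣p∣<∣q∣ U⊂) , pre′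
  where
  f0∉U : f zero ∉ U
  -- A preimage of `f zero` under `f ∘ suc` would give `suc i ≡ zero`.
  f0∉U f0∈U with inj (proj₂ (proj₂ (pre f0∈U)))
  ... | ()
  U⊂ : U ⊂ ⁅ f zero ⁆ ∪ U
  U⊂ = q⊆p∪q ⁅ f zero ⁆ U , f zero , p⊆p∪q U (x∈⁅x⁆ (f zero)) , f0∉U
  pre′ : ∀ {v} → v ∈ ⁅ f zero ⁆ ∪ U → ∃ λ i → i ∈ inside ∷ T × f i ≡ v
  pre′ v∈ with x∈p∪q⁻ ⁅ f zero ⁆ U v∈
  ... | inj₁ v∈⁅f0⁆ = zero , here , sym (x∈⁅y⁆⇒x≡y (f zero) v∈⁅f0⁆)
  ... | inj₂ v∈U = let i , i∈T , eq = pre v∈U in suc i , there i∈T , eq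

AtLeast-map : ∀ {m k} {P Q : Pred (Fin m) 0ℓ} → (∀ {i} → P i → Q i) → AtLeast k P → AtLeast k Q
AtLeast-map P⊆Q (T , k≤ , T⊆P) = T , k≤ , P⊆Q ∘ T⊆P

atLeast? : ∀ {m} k {P : Pred (Fin m) 0ℓ} → Decidable P → Dec (AtLeast k P)
atLeast? k P? = anySubset? λ T →
  (k ≤? ∣ T ∣) ×-dec map′ (λ h {i} → h i) (λ h i → h) (all? λ i → (i ∈? T) →-dec P? i)

allPairs? : ∀ {n} {R : Fin n → Fin n → Set} → (∀ x y → Dec (R x y)) →
            Dec (∀ {x y} → x ≢ y → R x y)
allPairs? R? = map′ (λ h {x} {y} → h x y) (λ h x y → h)
  (all? λ x → all? λ y → ¬? (x ≟ y) →-dec R? x y)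

-- Peeling off one entry at a time reduces the search over families to the search over single
-- subsets.
anySubsets? : ∀ {n p} {P : Pred (Vec (Subset n) p) 0ℓ} → Decidable P → Dec (∃ P)
anySubsets? {p = zero}  P? = map′ (λ P[] → [] , P[]) (λ { ([] , P[]) → P[] }) (P? [])
anySubsets? {p = suc p} P? =
  map′ (λ { (S , Ss , PSs) → S ∷ Ss , PSs }) (λ { (S ∷ Ss , PSs) → S , Ss , PSs })
       (anySubset? λ S → anySubsets? λ Ss → P? (S ∷ Ss))

singletons : ∀ n → Partition n n
singletons n = record
  { block    = ⁅_⁆
  ; nonempty = λ i → i , x∈⁅x⁆ i
  ; disjoint = λ {i} {j} i≢j (x , x∈) → let x∈i , x∈j = x∈p∩q⁻ ⁅ i ⁆ ⁅ j ⁆ x∈ in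
      i≢j (trans (sym (x∈⁅y⁆⇒x≡y i x∈i)) (x∈⁅y⁆⇒x≡y j x∈j))
  ; covers   = λ x → x , x∈⁅x⁆ x
  }

module _ {n : ℕ} (G : Graph n) where

  infixl 5 _∷ʳ_
  _∷ʳ_ : ∀ {x y z m} → Walk G x y m → Graph._~_ G y z → Walk G x z (suc m)
  []      ∷ʳ e = e ∷ []
  (f ∷ w) ∷ʳ e = f ∷ (w ∷ʳ e)

  reverse : ∀ {x y m} → Walk G x y m → Walk G y x m
  reverse []      = []
  reverse (e ∷ w) = reverse w ∷ʳ Graph.sym G e

module _ {n : ℕ} (G : Graph n) (conn : Connected G) where

  private
    dist = d G conn

  d-isLeast : ∀ x y → IsLeast (Walk G x y) (dist x y)
  d-isLeast x y = proj₂ (least (walk? G x y) (conn x y))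

  -- Reversal preserves the length of a walk. Symmetry is wanted because `dSet` measures from a
  -- vertex towards the set, whereas `DistinguishesVertex` measures from the separating vertex.
  d-sym : ∀ x y → dist x y ≡ dist y x
  d-sym x y = IsLeast-unique (reverse G) (reverse G) (d-isLeast x y) (d-isLeast y x)

  Attained : Fin n → Subset n → Pred ℕ 0ℓ
  Attained a S m = ∃ λ u → u ∈ S × dist a u ≡ m

  dSet-isLeast : ∀ a S ne → IsLeast (Attained a S) (dSet G conn a S ne)
  dSet-isLeast a S (v , v∈S) =
    proj₂ (least {Attained a S} (λ m → any? λ u → (u ∈? S) ×-dec (dist a u ℕ.≟ m))
                 (dist a v , v , v∈S , refl))

  -- The witness of nonemptiness only starts the search in `dSet`; the minimum found does not depend
  -- on it.
  DistinguishesSet-resp : ∀ {S S′} → S ≡ S′ → ∀ ne ne′ x y →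
    DistinguishesSet G conn S ne x y → DistinguishesSet G conn S′ ne′ x y
  DistinguishesSet-resp {S} refl ne ne′ x y dS eq = dS (trans (irr x ne ne′) (trans eq (irr y ne′ ne)))
    where
    irr : ∀ a ne ne′ → dSet G conn a S ne ≡ dSet G conn a S ne′
    irr a ne ne′ = IsLeast-unique (λ h → h) (λ h → h) (dSet-isLeast a S ne) (dSet-isLeast a S ne′)

  dSet-⁅⁆ : ∀ a v ne → dSet G conn a ⁅ v ⁆ ne ≡ dist v a
  dSet-⁅⁆ a v ne with proj₁ (dSet-isLeast a ⁅ v ⁆ ne)
  ... | u , u∈ , eq with x∈⁅y⁆⇒x≡y v u∈
  ... | refl = trans (sym eq) (d-sym a u)

  -- The attained distances from `x` and from `y` form the same set, hence have the same minimum. By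
  -- contraposition, a block that separates two vertices contains a vertex that separates them.
  dSet-≡ : ∀ S ne {x y} → (∀ {v} → v ∈ S → dist v x ≡ dist v y) →
           dSet G conn x S ne ≡ dSet G conn y S ne
  dSet-≡ S ne {x} {y} same = IsLeast-unique
    (λ { (u , u∈S , eq) → u , u∈S , trans (sym (flip u∈S)) eq })
    (λ { (u , u∈S , eq) → u , u∈S , trans (flip u∈S) eq })
    (dSet-isLeast x S ne) (dSet-isLeast y S ne)
    where
    flip : ∀ {u} → u ∈ S → dist x u ≡ dist y u
    flip {u} u∈S = trans (d-sym x u) (trans (same u∈S) (d-sym u y))

  distinguishesVertex? : ∀ v x y → Dec (DistinguishesVertex G conn v x y)
  distinguishesVertex? v x y = ¬? (dist v x ℕ.≟ dist v y)

  metricGenerator? : ∀ k → Decidable (IsMetricGenerator G conn k)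
  metricGenerator? k S = allPairs? λ x y →
    atLeast? k λ v → (v ∈? S) ×-dec distinguishesVertex? v x y

  metricBasis : ∀ {k} → ∃ (IsMetricGenerator G conn k) → ∃ (IsMetricBasis G conn k)
  metricBasis {k} (S , gen)
    -- The minimum is taken over the cardinalities of generators, starting from that of `S`.
    with least {λ m → ∃ λ S → IsMetricGenerator G conn k S × ∣ S ∣ ≡ m}
               (λ m → anySubset? λ S → metricGenerator? k S ×-dec (∣ S ∣ ℕ.≟ m))
               (∣ S ∣ , S , gen , refl)
  ... | _ , (B , genB , refl) , min = B , genB , λ S′ gen′ → min (S′ , gen′ , refl)

  HasPartitionGenerator : ℕ → Pred ℕ 0ℓ
  HasPartitionGenerator k p = ∃ λ (Π : Partition n p) → IsPartitionGenerator G conn k Π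

  Separates : ℕ → ∀ {p} (Ss : Vec (Subset n) p) → (∀ i → Nonempty (lookup Ss i)) → Set
  Separates k Ss ne =
    ∀ {x y} → x ≢ y → AtLeast k (λ i → DistinguishesSet G conn (lookup Ss i) (ne i) x y)

  separates? : ∀ k {p} (Ss : Vec (Subset n) p) ne → Dec (Separates k Ss ne)
  separates? k Ss ne = allPairs? λ x y → atLeast? k λ i →
    ¬? (dSet G conn x (lookup Ss i) (ne i) ℕ.≟ dSet G conn y (lookup Ss i) (ne i))

  -- Partition n p in first-order form, so that it can be searched exhaustively.
  IsGeneratingFamily : ℕ → ∀ {p} → Pred (Vec (Subset n) p) 0ℓ
  IsGeneratingFamily k Ss =
    (∀ i j → i ≢ j → Empty (lookup Ss i ∩ lookup Ss j)) ×
    (∀ x → ∃ λ i → x ∈ lookup Ss i) ×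
    ∃ λ (ne : ∀ i → Nonempty (lookup Ss i)) → Separates k Ss ne

  generatingFamily? : ∀ k {p} → Decidable (IsGeneratingFamily k {p})
  generatingFamily? k Ss =
    (all? λ i → all? λ j → ¬? (i ≟ j) →-dec ¬? (nonempty? (lookup Ss i ∩ lookup Ss j))) ×-dec
    (all? λ x → any? λ i → x ∈? lookup Ss i) ×-dec
    separating?
    where
    separating? : Dec (∃ λ (ne : ∀ i → Nonempty (lookup Ss i)) → Separates k Ss ne)
    separating? with all? (λ i → nonempty? (lookup Ss i))
    ... | no ¬ne = no (¬ne ∘ proj₁)
    ... | yes ne with separates? k Ss ne
    ... | yes sep = yes (ne , sep)
    -- Failure for the one witness `ne` refutes every other `ne′`, since distances to blocks ignore
    -- the witness.
    ... | no ¬sep = no λ (ne′ , sep) → ¬sep λ {x} {y} x≢y →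
      AtLeast-map (λ {i} → DistinguishesSet-resp refl (ne′ i) (ne i) x y) (sep x≢y)

  hasPartitionGenerator? : ∀ k → Decidable (HasPartitionGenerator k)
  hasPartitionGenerator? k p = map′ to from (anySubsets? (generatingFamily? k))
    where
    to : ∃ (IsGeneratingFamily k {p}) → HasPartitionGenerator k p
    to (Ss , disj , cov , ne , gen) =
      record { block = lookup Ss ; nonempty = ne ; disjoint = disj _ _ ; covers = cov } , gen
    from : HasPartitionGenerator k p → ∃ (IsGeneratingFamily k {p})
    -- `lookup (tabulate block)` agrees with `block` only pointwise and propositionally, so each
    -- field is transported along `eq`.
    from (Π , gen) = tabulate block , disj , cov , ne ,
      λ {x} {y} x≢y →
        AtLeast-map (λ {i} → DistinguishesSet-resp (eq i) (nonempty i) (ne i) x y) (gen x≢y)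
      where
      open Partition Π
      eq : ∀ i → block i ≡ lookup (tabulate block) i
      eq i = sym (lookup∘tabulate block i)
      disj : ∀ i j → i ≢ j → Empty (lookup (tabulate block) i ∩ lookup (tabulate block) j)
      disj i j i≢j = subst₂ (λ S S′ → Empty (S ∩ S′)) (eq i) (eq j) (disjoint i≢j)
      cov : ∀ x → ∃ λ i → x ∈ lookup (tabulate block) i
      cov x = let i , x∈ = covers x in i , subst (x ∈_) (eq i) x∈
      ne : ∀ i → Nonempty (lookup (tabulate block) i)
      ne i = subst Nonempty (eq i) (nonempty i)

  partitionBasis : ∀ {k} → ∃ (HasPartitionGenerator k) →
                   ∃ λ p → ∃ λ (Π : Partition n p) → IsPartitionBasis G conn k Π
  partitionBasis {k} has with least (hasPartitionGenerator? k) has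
  ... | p , (Π , gen) , min = p , Π , gen , λ Π′ gen′ → min (Π′ , gen′)

  -- Blocks are indexed by vertices here, and the distance to a singleton is the distance to its
  -- element, so the separating vertices serve unchanged as separating indices.
  metric⇒partition : ∀ {k S} → IsMetricGenerator G conn k S →
                     IsPartitionGenerator G conn k (singletons n)
  metric⇒partition gen {x} {y} x≢y = AtLeast-map
    (λ {v} (_ , dv) eq → let ne = v , x∈⁅x⁆ v in
      dv (trans (sym (dSet-⁅⁆ x v ne)) (trans eq (dSet-⁅⁆ y v ne)))) (gen x≢y)

  partition⇒metric : ∀ {k p} (Π : Partition n p) → IsPartitionGenerator G conn k Π →
                     IsMetricGenerator G conn k ⊤
  partition⇒metric {k} {p} Π gen {x} {y} x≢y =
    let T , k≤T , T⊆ = gen x≢y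
        U , T≤U , U⊆ = image-AtLeast rep rep-injective T
    in U , ℕ.≤-trans k≤T T≤U , λ v∈U → ∈⊤ ,
       (let i , i∈T , eq = U⊆ v∈U in
        subst (λ v → DistinguishesVertex G conn v x y) eq (rep-distinguishes i (T⊆ i∈T)))
    where
    open Partition Π
    -- The choice depends on the pair `x`, `y`. It is made for every block, separating or not, so
    -- that `rep` is a total function to which `image-AtLeast` applies.
    representative : ∀ i → ∃ λ v → v ∈ block i ×
      (DistinguishesSet G conn (block i) (nonempty i) x y → DistinguishesVertex G conn v x y)
    representative i with any? (λ v → (v ∈? block i) ×-dec distinguishesVertex? v x y)
    ... | yes (v , v∈ , dv) = v , v∈ , λ _ → dv
    -- Any vertex of the block serves as default: with no separating vertex inside, the block cannot
    -- separate the pair.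
    ... | no none = proj₁ (nonempty i) , proj₂ (nonempty i) , λ dS →
      contradiction (dSet-≡ (block i) (nonempty i) λ {v} v∈ →
        decidable-stable (dist v x ℕ.≟ dist v y) λ dv → none (v , v∈ , dv)) dS
    rep : Fin p → Fin n
    rep = proj₁ ∘ representative
    rep-distinguishes : ∀ i → DistinguishesSet G conn (block i) (nonempty i) x y →
                        DistinguishesVertex G conn (rep i) x y
    rep-distinguishes i = proj₂ (proj₂ (representative i))
    rep∈ : ∀ i → rep i ∈ block i
    rep∈ i = proj₁ (proj₂ (representative i))
    rep-injective : Injective _≡_ _≡_ rep
    -- A shared representative would lie in two disjoint blocks.
    rep-injective {i} {j} eq = decidable-stable (i ≟ j) λ i≢j →
      disjoint i≢j (rep i , x∈p∩q⁺ (rep∈ i , subst (_∈ block j) (sym eq) (rep∈ j)))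

theorem6 : ∀ {n : ℕ} (G : Graph n) (conn : Connected G) → 2 ≤ n →
    ∀ (k : ℕ) → 1 ≤ k →
    PartitionDimensional G conn k ⇔ MetricDimensional G conn k
theorem6 G conn _ k _ = mk⇔ (IsGreatest-cong toMetric toPartition)
                            (IsGreatest-cong toPartition toMetric)
  where
  toMetric : ∀ {k} → ∃ (λ p → ∃ λ (Π : Partition _ p) → IsPartitionBasis G conn k Π) →
             ∃ (IsMetricBasis G conn k)
  -- `⊤` is a generator but perhaps not a smallest one; `metricBasis` passes to one of minimum size.
  toMetric (_ , Π , gen , _) = metricBasis G conn (⊤ , partition⇒metric G conn Π gen)
  toPartition : ∀ {k} → ∃ (IsMetricBasis G conn k) →
                ∃ λ p → ∃ λ (Π : Partition _ p) → IsPartitionBasis G conn k Π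
  toPartition (_ , gen , _) = partitionBasis G conn (_ , singletons _ , metric⇒partition G conn gen)
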